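{- Let $(G,\precsim)$ be a C-quasi-ordered group. For any $g,h\in G$ the following conditions are equivalent: $g\in T_h$; $\ h\in T_g$; $\ T_g=T_h$; $\ T_g\cap T_h\neq\varnothing$; $\ G_g=G_h$; $\ G^g=G^h$.
   Context: A quasi-order is a reflexive, transitive and total binary relation $\precsim$; $a\sim b$ means $a\precsim b\precsim a$, and $a\precnsim b$ means $a\precsim b$ and $a\nsim b$. An element $c$ is between $a$ and $b$ if $a\precsim c\precsim b$ or $b\precsim c\precsim a$. A C-relation on a set is a ternary relation $C$ such that for all $x,y,z,w$: $C(x,y,z)\Rightarrow C(x,z,y)$; $C(x,y,z)\Rightarrow\neg C(y,x,z)$; $C(x,y,z)\Rightarrow C(w,y,z)\vee C(x,w,z)$; $x\neq y\Rightarrow C(x,y,y)$. On a group it is compatible if $C(x,y,z)$ implies $C(vxu,vyu,vzu)$ for all $x,y,z,u,v$. A C-quasi-order on a group $G$ is a quasi-order of the form $x\precsim y\Leftrightarrow\neg C(x,y,1)$ with $C$ a compatible C-relation; a C-quasi-ordered group is a group with a C-quasi-order. $g$ is v-type if $g\sim g^{ -1}$; $o^+$-type if $g^{ -1}\precnsim g$; $o^-$-type if $g\precnsim g^{ -1}$. For $g\neq1$: if $g$ is v-type, $T_g$ is the set of v-type $h\neq1$ such that there is no $o^+$-type element between $h$ and $g$, and $G_g:=\{h\mid h\precnsim t\text{ for all }t\in T_g\}$; if $g$ is $o^+$-type, $T_g:=T_g^+\cup (T_g^+)^{ -1}$, where $T_g^+$ is the set of $o^+$-type $h$ such that every element between $g$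 and $h$ is $o^+$-type, and $G_g:=\{h\mid h\precsim g^{ -1}\wedge h^{ -1}\precsim g^{ -1}\}$; if $g$ is $o^-$-type, $T_g:=T_{g^{ -1}}$ and $G_g:=G_{g^{ -1}}$. In all these cases $G^g:=G_g\cup T_g$. For $g=1$, $T_1=G^1=G_1=\{1\}$.
   Formalization: The implication from G_g=G_h to the other conditions is claimed only when g and h are both 1 or both not 1, since it can fail otherwise (Z/2 with C(x,y,z) iff y=z≠x, g≠1, h=1); all other implications are kept for every g,h. -}

module Defs where

open import Level using (suc; _⊔_)
open import Algebra.Bundles using (Group)
open import Data.Product using (_×_; ∃-syntax)
open import Data.Sum using (_⊎_)
open import Data.List using (List)
open import Data.List.Relation.Unary.AllPairs using (AllPairs)
open import Function.Bundles using (_⇔_)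
open import Relation.Binary.Core using (Rel)
open import Relation.Binary.Structures using (IsTotalPreorder)
open import Relation.Nullary using (¬_)
open import Relation.Unary using (Pred; _∪_)

module _ {c ℓ} (𝔾 : Group c ℓ) where

  open Group 𝔾

  record IsCompatibleCRelation {s} (C : Carrier → Carrier → Carrier → Set s)
         : Set (c ⊔ ℓ ⊔ s) where
    field
      -- C is a relation on the quotient of the carrier by _≈_.
      C-resp-≈    : ∀ {x x′ y y′ z z′} → x ≈ x′ → y ≈ y′ → z ≈ z′ →
                    C x y z → C x′ y′ z′
      C-swap      : ∀ {x y z} → C x y z → C x z y
      C-asym      : ∀ {x y z} → C x y z → ¬ C y x z
      C-split     : ∀ {x y z} w → C x y z → C w y z ⊎ C x w z
      C-distinct  : ∀ {x y} → ¬ (x ≈ y) → C x y y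
      C-compat    : ∀ {x y z} u v → C x y z →
                    C (v ∙ x ∙ u) (v ∙ y ∙ u) (v ∙ z ∙ u)

  record IsCQuasiOrder {r} s (_≾_ : Rel Carrier r) : Set (c ⊔ ℓ ⊔ r ⊔ suc s) where
    field
      isTotalPreorder       : IsTotalPreorder _≈_ _≾_
      C                     : Carrier → Carrier → Carrier → Set s
      isCompatibleCRelation : IsCompatibleCRelation C
      ≾⇔¬C                  : ∀ x y → x ≾ y ⇔ (¬ C x y ε)

record CQuasiOrderedGroup c ℓ r s : Set (suc (c ⊔ ℓ ⊔ r ⊔ s)) where
  infix 4 _≾_
  field
    group         : Group c ℓ
    _≾_           : Rel (Group.Carrier group) r
    isCQuasiOrder : IsCQuasiOrder group s _≾_
  open Group group public
  open IsCQuasiOrder isCQuasiOrder public using (isTotalPreorder)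

module Types {c ℓ r s} (𝔾 : CQuasiOrderedGroup c ℓ r s) where

  open CQuasiOrderedGroup 𝔾

  infix 4 _∼_ _⋨_

  _∼_ : Rel Carrier r
  a ∼ b = a ≾ b × b ≾ a

  _⋨_ : Rel Carrier r
  a ⋨ b = a ≾ b × ¬ (a ∼ b)

  Between : Carrier → Carrier → Carrier → Set r
  Between a b x = (a ≾ x × x ≾ b) ⊎ (b ≾ x × x ≾ a)

  VType O⁺Type O⁻Type : Pred Carrier r
  VType  g = g ∼ g ⁻¹
  O⁺Type g = g ⁻¹ ⋨ g
  O⁻Type g = g ⋨ g ⁻¹

  Inverses : ∀ {p} → Pred Carrier p → Pred Carrier (c ⊔ ℓ ⊔ p)
  Inverses P x = ∃[ y ] (P y × x ≈ y ⁻¹)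

  T⁺ : Carrier → Pred Carrier (c ⊔ r)
  T⁺ g h = O⁺Type h × (∀ x → Between g h x → O⁺Type x)

  -- T g and G↓ g are defined by cases on the type of g, one constructor per
  -- case.  In the o⁺ and o⁻ cases g is automatically different from ε.
  data T : Carrier → Pred Carrier (c ⊔ ℓ ⊔ r) where
    T-ε  : ∀ {g h} → g ≈ ε → h ≈ ε → T g h
    T-v  : ∀ {g h} → ¬ (g ≈ ε) → VType g →
           VType h → ¬ (h ≈ ε) → ¬ (∃[ x ] (O⁺Type x × Between h g x)) → T g h
    T-o⁺ : ∀ {g h} → O⁺Type g → (T⁺ g ∪ Inverses (T⁺ g)) h → T g h
    T-o⁻ : ∀ {g h} → O⁻Type g → T (g ⁻¹) h → T g h

  -- The set written with g as a subscript.
  data G↓ : Carrier → Pred Carrier (c ⊔ ℓ ⊔ r) where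
    G-ε  : ∀ {g h} → g ≈ ε → h ≈ ε → G↓ g h
    G-v  : ∀ {g h} → ¬ (g ≈ ε) → VType g → (∀ t → T g t → h ⋨ t) → G↓ g h
    G-o⁺ : ∀ {g h} → O⁺Type g → h ≾ g ⁻¹ → h ⁻¹ ≾ g ⁻¹ → G↓ g h
    G-o⁻ : ∀ {g h} → O⁻Type g → G↓ (g ⁻¹) h → G↓ g h

  -- The set written with g as a superscript.
  G↑ : Carrier → Pred Carrier (c ⊔ ℓ ⊔ r)
  G↑ g = G↓ g ∪ T g

AllEquivalent : ∀ {a} → List (Set a) → Set (suc a)
AllEquivalent = AllPairs _⇔_

{-# OPTIONS --safe #-}
module Submission where

-- Write x ≺ y for ¬ (y ≾ x), that is, C y x ε.  The group enters through two
-- consequences of compatibility: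
--   * h⁻¹ ≺ g⁻¹ implies g h⁻¹ ∼ g and h ≺ (g h⁻¹)⁻¹, which forces g⁻¹ ∼ h⁻¹
--     when everything between the o⁺-type elements g and h is o⁺-type, so that
--     G↓ is constant on T-classes;
--   * h⁻¹ ≺ y and h⁻¹ ≺ y⁻¹ imply h ≺ y, so that whatever is ∼ to an o⁺-type
--     element is o⁺-type (hence T is reflexive), and of two elements in
--     different T-classes one lies in the G↓ of the other.
-- Symmetry and transitivity of T are purely order-theoretic.  As g ∉ G↓ g for
-- g ≉ ε, and g ∈ G↓ h and h ∈ G↓ g hold together only inside one T-class, both
-- G↓ (away from ε) and G↑ determine the class.

open import Defs
open import Level using (Level; _⊔_; Lift; lift; lower)
open import Axiom.ExcludedMiddle using (ExcludedMiddle)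
import Algebra.Properties.Group as GroupProperties
open import Data.List using (List; []; _∷_)
open import Data.List.Relation.Unary.All as All using (All; []; _∷_)
open import Data.List.Relation.Unary.AllPairs using ([]; _∷_)
open import Data.Product using (_×_; _,_; proj₁; proj₂; ∃-syntax; swap)
open import Data.Sum as Sum using (_⊎_; inj₁; inj₂; [_,_]′)
open import Function.Base using (_∘_)
open import Function.Bundles using (_⇔_; mk⇔; Equivalence)
open import Function.Construct.Composition using (_⇔-∘_)
open import Function.Construct.Symmetry using (⇔-sym)
open import Relation.Binary.Core using (Rel)
open import Relation.Binary.Structures using (IsTotalPreorder)
open import Relation.Nullary using (¬_; yes; no; contradiction)
open import Relation.Nullary.Decidable using (map′; decidable-stable)
open import Relation.Unary using (_∈_; _⊆_; _∪_; _≐_; _≬_)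

-- Excluded middle at smaller levels, and lists of equivalences.

lower-em : ∀ {a} b → ExcludedMiddle (a ⊔ b) → ExcludedMiddle a
lower-em b em {P} = map′ lower lift (em {Lift b P})

-- Any two conditions are linked through the head `P`.
allEquivalent : ∀ {a} {P : Set a} {Ps : List (Set a)} →
                All (P ⇔_) Ps → AllEquivalent (P ∷ Ps)
allEquivalent {P = P} P⇔Ps = P⇔Ps ∷ pairs P⇔Ps
  where
  pairs : ∀ {Qs} → All (P ⇔_) Qs → AllEquivalent Qs
  pairs []             = []
  pairs (P⇔Q ∷ P⇔Qs) = All.map (_⇔-∘ ⇔-sym P⇔Q) P⇔Qs ∷ pairs P⇔Qs

module CQuasiOrder {c ℓ r s} (em : ExcludedMiddle (c ⊔ ℓ ⊔ r ⊔ s))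
                   (𝔾 : CQuasiOrderedGroup c ℓ r s) where

  open CQuasiOrderedGroup 𝔾
  open Types 𝔾
  open IsCQuasiOrder isCQuasiOrder using (C; isCompatibleCRelation; ≾⇔¬C)
  open IsCompatibleCRelation isCompatibleCRelation
  open IsTotalPreorder isTotalPreorder using (total)
    renaming (refl to ≾-refl; reflexive to ≾-reflexive; trans to ≾-trans)
  open GroupProperties group

  -- The strict relation and its reading as `C`.

  infix 4 _≺_ _≈±_

  _≺_ : Rel Carrier r
  a ≺ b = ¬ (b ≾ a)

  _≈±_ : Rel Carrier ℓ
  g ≈± p = g ≈ p ⊎ g ≈ p ⁻¹

  em-ℓ : ExcludedMiddle ℓ
  em-ℓ = lower-em (c ⊔ r ⊔ s) em

  em-r : ExcludedMiddle r
  em-r = lower-em (c ⊔ ℓ ⊔ s) em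

  em-s : ExcludedMiddle s
  em-s = lower-em (c ⊔ ℓ ⊔ r) em

  em-cr : ExcludedMiddle (c ⊔ r)
  em-cr = lower-em (ℓ ⊔ s) em

  ≾-≈ : ∀ {x x′ y y′} → x ≈ x′ → y ≈ y′ → x ≾ y → x′ ≾ y′
  ≾-≈ x≈x′ y≈y′ x≾y =
    ≾-trans (≾-reflexive (sym x≈x′)) (≾-trans x≾y (≾-reflexive y≈y′))

  ≺⇒≾ : ∀ {a b} → a ≺ b → a ≾ b
  ≺⇒≾ {a} {b} a≺b = [ (λ a≾b → a≾b) , (λ b≾a → contradiction b≾a a≺b) ]′ (total a b)

  ≺⇒⋨ : ∀ {a b} → a ≺ b → a ⋨ b
  ≺⇒⋨ a≺b = ≺⇒≾ a≺b , a≺b ∘ proj₂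

  ⋨⇒≺ : ∀ {a b} → a ⋨ b → a ≺ b
  ⋨⇒≺ (a≾b , a≁b) b≾a = a≁b (a≾b , b≾a)

  ≺⇒C : ∀ {a b} → a ≺ b → C b a ε
  ≺⇒C {a} {b} a≺b =
    decidable-stable em-s (λ ¬C → a≺b (Equivalence.from (≾⇔¬C b a) ¬C))

  C⇒≺ : ∀ {a b} → C b a ε → a ≺ b
  C⇒≺ {a} {b} Cbaε b≾a = Equivalence.to (≾⇔¬C b a) b≾a Cbaε

  -- Consequences of compatibility.

  C-∙ˡ : ∀ v {x y z} → C x y z → C (v ∙ x) (v ∙ y) (v ∙ z)
  C-∙ˡ v Cxyz = C-resp-≈ (identityʳ _) (identityʳ _) (identityʳ _) (C-compat ε v Cxyz)

  C-∙ʳ : ∀ u {x y z} → C x y z → C (x ∙ u) (y ∙ u) (z ∙ u)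
  C-∙ʳ u Cxyz = C-resp-≈ e e e (C-compat u ε Cxyz)
    where
    e : ∀ {x} → ε ∙ x ∙ u ≈ x ∙ u
    e = ∙-congʳ (identityˡ _)

  ε≺ : ∀ {y} → ¬ (y ≈ ε) → ε ≺ y
  ε≺ y≉ε = C⇒≺ (C-distinct y≉ε)

  ε≾ : ∀ y → ε ≾ y
  ε≾ y with em-ℓ {y ≈ ε}
  ... | yes y≈ε = ≾-reflexive (sym y≈ε)
  ... | no y≉ε  = ≺⇒≾ (ε≺ y≉ε)

  -- Left translation by `g` turns the hypothesis into `C ε (g ∙ h ⁻¹) g`; by asymmetry `C` then
  -- isolates neither `g ∙ h ⁻¹` nor `g` from the other two.
  g∙h⁻¹∼g : ∀ {g h} → h ⁻¹ ≺ g ⁻¹ → g ∙ h ⁻¹ ∼ g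
  g∙h⁻¹∼g {g} {h} h⁻¹≺g⁻¹ = Equivalence.from (≾⇔¬C _ _) (C-asym Cεg₁ ∘ C-swap)
                         , Equivalence.from (≾⇔¬C _ _) (C-asym (C-swap Cεg₁) ∘ C-swap)
    where
    Cεg₁ : C ε (g ∙ h ⁻¹) g
    Cεg₁ = C-resp-≈ (inverseʳ g) refl (identityʳ g) (C-∙ˡ g (≺⇒C h⁻¹≺g⁻¹))

  -- Left translation by `h` instead gives `C (h ∙ g ⁻¹) ε h`.
  h≺[g∙h⁻¹]⁻¹ : ∀ {g h} → h ⁻¹ ≺ g ⁻¹ → h ≺ (g ∙ h ⁻¹) ⁻¹
  h≺[g∙h⁻¹]⁻¹ {g} {h} h⁻¹≺g⁻¹ = C⇒≺ (C-swap
    (C-resp-≈ (sym (⁻¹-anti-homo-// g h)) (inverseʳ h) (identityʳ h)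
      (C-∙ˡ h (≺⇒C h⁻¹≺g⁻¹))))

  -- Splitting `C (y ∙ h) ε h` at `y` leaves either the claim or `C (y ∙ h) y h`.
  h⁻¹≺y,y⁻¹⇒h≺y : ∀ {h y} → h ⁻¹ ≺ y → h ⁻¹ ≺ y ⁻¹ → h ≺ y
  h⁻¹≺y,y⁻¹⇒h≺y {h} {y} h⁻¹≺y h⁻¹≺y⁻¹ with C-split y C[yh,ε,h]
    where
    C[yh,ε,h] : C (y ∙ h) ε h
    C[yh,ε,h] = C-resp-≈ refl (inverseˡ h) (identityˡ h) (C-∙ʳ h (≺⇒C h⁻¹≺y))
  ... | inj₁ C[y,ε,h]  = C⇒≺ (C-swap C[y,ε,h])
  -- The second hypothesis, translated by `y` on the left and `h` on the right, isolates `h` from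
  -- `y` and `y ∙ h`, so `y ∙ h` cannot be isolated.
  ... | inj₂ C[yh,y,h] = contradiction (C-swap C[yh,y,h]) (C-asym (C-swap C[h,y,yh]))
    where
    C[h,y,yh] : C h y (y ∙ h)
    C[h,y,yh] = C-resp-≈ (\\-leftDividesˡ y h)
      (trans (∙-congˡ (inverseˡ h)) (identityʳ y))
      (∙-congˡ (identityˡ h))
      (C-∙ˡ y (C-∙ʳ h (≺⇒C h⁻¹≺y⁻¹)))

  -- Types and inverses.

  VType-ε : ∀ {g} → g ≈ ε → VType g
  VType-ε g≈ε = ≾-reflexive g≈g⁻¹ , ≾-reflexive (sym g≈g⁻¹)
    where g≈g⁻¹ = trans g≈ε (trans (sym ε⁻¹≈ε) (⁻¹-cong (sym g≈ε)))

  O⁺-⁻¹ : ∀ {p} → O⁺Type p → ¬ O⁺Type (p ⁻¹)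
  O⁺-⁻¹ op op⁻¹ = ⋨⇒≺ op (≾-≈ (⁻¹-involutive _) refl (proj₁ op⁻¹))

  -- As `y ≾ y ⁻¹`, having `q ⁻¹ ≺ y` would put `q ⁻¹` strictly below both `y` and `y ⁻¹`, which
  -- forces `q ≺ y`.
  ¬O⁺∧≾⇒≾⁻¹ : ∀ {y q} → ¬ O⁺Type y → y ≾ q → y ≾ q ⁻¹
  ¬O⁺∧≾⇒≾⁻¹ ¬oy y≾q = decidable-stable em-r λ q⁻¹≺y →
    h⁻¹≺y,y⁻¹⇒h≺y q⁻¹≺y (λ y⁻¹≾q⁻¹ → ¬oy (≺⇒⋨ λ y≾y⁻¹ → q⁻¹≺y (≾-trans y≾y⁻¹ y⁻¹≾q⁻¹))) y≾q

  ⁻¹-flip : ∀ {g p} → g ≈ p ⁻¹ → g ⁻¹ ≈ p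
  ⁻¹-flip g≈p⁻¹ = trans (⁻¹-cong g≈p⁻¹) (⁻¹-involutive _)

  O⁻-intro : ∀ {g p} → O⁺Type p → g ≈ p ⁻¹ → O⁻Type g
  O⁻-intro op g≈p⁻¹ = ≺⇒⋨ (⋨⇒≺ op ∘ ≾-≈ (⁻¹-flip g≈p⁻¹) g≈p⁻¹)

  ≈±-sym : ∀ {g p} → g ≈± p → p ≈± g
  ≈±-sym (inj₁ g≈p)   = inj₁ (sym g≈p)
  ≈±-sym (inj₂ g≈p⁻¹) = inj₂ (sym (⁻¹-flip g≈p⁻¹))

  ≈±-⁻¹ : ∀ {g p} → g ≈± p → g ⁻¹ ≈± p
  ≈±-⁻¹ (inj₁ g≈p)   = inj₂ (⁻¹-cong g≈p)
  ≈±-⁻¹ (inj₂ g≈p⁻¹) = inj₁ (⁻¹-flip g≈p⁻¹)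

  ≈±-≾ : ∀ {g p a} → g ≈± p → p ≾ a → p ⁻¹ ≾ a → g ≾ a
  ≈±-≾ (inj₁ g≈p)   p≾a _      = ≾-≈ (sym g≈p) refl p≾a
  ≈±-≾ (inj₂ g≈p⁻¹) _   p⁻¹≾a = ≾-≈ (sym g≈p⁻¹) refl p⁻¹≾a

  O⁺-≈±-≾ : ∀ {g p} → O⁺Type p → g ≈± p → g ≾ p
  O⁺-≈±-≾ op g≈±p = ≈±-≾ g≈±p ≾-refl (proj₁ op)

  O⁺-≈±-≿ : ∀ {g p} → O⁺Type p → g ≈± p → p ⁻¹ ≾ g
  O⁺-≈±-≿ op (inj₁ g≈p)   = ≾-≈ refl (sym g≈p) (proj₁ op)
  O⁺-≈±-≿ op (inj₂ g≈p⁻¹) = ≾-reflexive (sym g≈p⁻¹)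

  O⁺-resp-≈ : ∀ {p q} → p ≈ q → O⁺Type p → O⁺Type q
  O⁺-resp-≈ p≈q op = ≺⇒⋨ (⋨⇒≺ op ∘ ≾-≈ (sym p≈q) (⁻¹-cong (sym p≈q)))

  O⁺-≈±⇒¬VType : ∀ {g p} → O⁺Type p → g ≈± p → ¬ VType g
  O⁺-≈±⇒¬VType op (inj₁ g≈p) (g≾g⁻¹ , _) = ⋨⇒≺ op (≾-≈ g≈p (⁻¹-cong g≈p) g≾g⁻¹)
  O⁺-≈±⇒¬VType op (inj₂ g≈p⁻¹) (_ , g⁻¹≾g) =
    ⋨⇒≺ op (≾-≈ (⁻¹-flip g≈p⁻¹) g≈p⁻¹ g⁻¹≾g)

  -- Betweenness, and `T⁺` as an equivalence on o⁺-type elements.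

  Between-split : ∀ {a b d x} → Between a d x → Between a b x ⊎ Between b d x
  Between-split {b = b} {x = x} (inj₁ (a≾x , x≾d)) with total x b
  ... | inj₁ x≾b = inj₁ (inj₁ (a≾x , x≾b))
  ... | inj₂ b≾x = inj₂ (inj₁ (b≾x , x≾d))
  Between-split {b = b} {x = x} (inj₂ (d≾x , x≾a)) with total x b
  ... | inj₁ x≾b = inj₂ (inj₂ (d≾x , x≾b))
  ... | inj₂ b≾x = inj₁ (inj₂ (b≾x , x≾a))

  Between-≾ : ∀ {a b x} → a ≾ b → Between a b x → a ≾ x × x ≾ b
  Between-≾ a≾b (inj₁ a≾x≾b)         = a≾x≾b
  Between-≾ a≾b (inj₂ (b≾x , x≾a)) = ≾-trans a≾b b≾x , ≾-trans x≾a a≾b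

  -- The elements between `p` and `p` are those with `x ∼ p`; one that is not o⁺-type would give
  -- `p ≾ x ≾ p ⁻¹`.
  T⁺-refl : ∀ {p} → O⁺Type p → T⁺ p p
  T⁺-refl {p} op = op , λ x → ∼p⇒O⁺ x ∘ Between-≾ ≾-refl
    where
    ∼p⇒O⁺ : ∀ x → p ≾ x × x ≾ p → O⁺Type x
    ∼p⇒O⁺ x (p≾x , x≾p) =
      decidable-stable em-r (λ ¬ox → ⋨⇒≺ op (≾-trans p≾x (¬O⁺∧≾⇒≾⁻¹ ¬ox x≾p)))

  T⁺-sym : ∀ {p q} → T⁺ p q → T⁺ q p
  T⁺-sym {p} {q} (_ , o) =
    -- `p` itself lies between `p` and `q`, hence is o⁺-type.
    o p ([ (λ p≾q → inj₁ (≾-refl , p≾q)) , (λ q≾p → inj₂ (q≾p , ≾-refl)) ]′ (total p q))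
    , λ x → o x ∘ Sum.swap

  T⁺-trans : ∀ {p q k} → T⁺ p q → T⁺ q k → T⁺ p k
  T⁺-trans (_ , o₁) (ok , o₂) = ok , λ x → [ o₁ x , o₂ x ]′ ∘ Between-split

  T⁺-respˡ-≈ : ∀ {p p′ q} → p ≈ p′ → T⁺ p q → T⁺ p′ q
  T⁺-respˡ-≈ p≈p′ (oq , o) =
    oq , λ x → o x ∘ Sum.map (λ (p′≾x , x≾q) → ≾-≈ (sym p≈p′) refl p′≾x , x≾q)
                             (λ (q≾x , x≾p′) → q≾x , ≾-≈ refl (sym p≈p′) x≾p′)

  T⁺-respʳ-≈ : ∀ {p q q′} → q ≈ q′ → T⁺ p q → T⁺ p q′
  T⁺-respʳ-≈ q≈q′ = T⁺-sym ∘ T⁺-respˡ-≈ q≈q′ ∘ T⁺-sym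

  T⁺⇒⁻¹-≾ : ∀ {g h} → T⁺ g h → g ≾ h → g ⁻¹ ∼ h ⁻¹
  T⁺⇒⁻¹-≾ {g} {h} (_ , o) g≾h =
    decidable-stable em-r h⁻¹⊀g⁻¹ , decidable-stable em-r g⁻¹⊀h⁻¹
    where
    -- Here w = g h⁻¹ ∼ g is between g and h, so it is o⁺-type and w⁻¹ ≾ w.
    h⁻¹⊀g⁻¹ : ¬ (h ⁻¹ ≺ g ⁻¹)
    h⁻¹⊀g⁻¹ h⁻¹≺g⁻¹ =
      let w≾g , g≾w = g∙h⁻¹∼g h⁻¹≺g⁻¹
          ow        = o (g ∙ h ⁻¹) (inj₁ (g≾w , ≾-trans w≾g g≾h))
      in h≺[g∙h⁻¹]⁻¹ h⁻¹≺g⁻¹ (≾-trans (proj₁ ow) (≾-trans w≾g g≾h))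

    -- Here w = h g⁻¹ ∼ h, and both w and w⁻¹ are between g and h.
    g⁻¹⊀h⁻¹ : ¬ (g ⁻¹ ≺ h ⁻¹)
    g⁻¹⊀h⁻¹ g⁻¹≺h⁻¹ =
      let w≾h , h≾w = g∙h⁻¹∼g g⁻¹≺h⁻¹
          ow        = o (h ∙ g ⁻¹) (inj₁ (≾-trans g≾h h≾w , w≾h))
          g≾w⁻¹     = ≺⇒≾ (h≺[g∙h⁻¹]⁻¹ g⁻¹≺h⁻¹)
      in O⁺-⁻¹ ow (o ((h ∙ g ⁻¹) ⁻¹) (inj₁ (g≾w⁻¹ , ≾-trans (proj₁ ow) w≾h)))

  T⁺⇒⁻¹-∼ : ∀ {g h} → T⁺ g h → g ⁻¹ ∼ h ⁻¹
  T⁺⇒⁻¹-∼ {g} {h} t =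
    [ T⁺⇒⁻¹-≾ t , (λ h≾g → swap (T⁺⇒⁻¹-≾ (T⁺-sym t) h≾g)) ]′ (total g h)

  -- The o⁺ and o⁻ cases are merged: p is the o⁺-type one among g and g ⁻¹.
  data Kind (g : Carrier) : Set (c ⊔ ℓ ⊔ r) where
    trivial : g ≈ ε → Kind g
    valued  : ¬ (g ≈ ε) → VType g → Kind g
    ordered : ∀ {p} → O⁺Type p → g ≈± p → Kind g

  kind : ∀ g → Kind g
  kind g with em-ℓ {g ≈ ε} | em-r {g ≾ g ⁻¹} | em-r {g ⁻¹ ≾ g}
  ... | yes g≈ε | _           | _           = trivial g≈ε
  ... | no g≉ε  | yes g≾g⁻¹ | yes g⁻¹≾g = valued g≉ε (g≾g⁻¹ , g⁻¹≾g)
  ... | no _    | no g⁻¹≺g  | _           = ordered (≺⇒⋨ g⁻¹≺g) (inj₁ refl)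
  ... | no _    | yes _       | no g≺g⁻¹  =
    ordered (≺⇒⋨ (g≺g⁻¹ ∘ ≾-≈ refl (⁻¹-involutive g))) (inj₂ (sym (⁻¹-involutive g)))

  -- Membership in `T` by kind; `T` is an equivalence relation.

  T-trivial : ∀ {g h} → g ≈ ε → T g h → h ≈ ε
  T-trivial g≈ε (T-ε _ h≈ε)        = h≈ε
  T-trivial g≈ε (T-v g≉ε _ _ _ _)  = contradiction g≈ε g≉ε
  T-trivial g≈ε (T-o⁺ og _)        = contradiction (VType-ε g≈ε) (O⁺-≈±⇒¬VType og (inj₁ refl))
  T-trivial g≈ε (T-o⁻ (_ , g≁g⁻¹) _) = contradiction (VType-ε g≈ε) g≁g⁻¹

  T-valued : ∀ {g h} → ¬ (g ≈ ε) → VType g → T g h →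
             VType h × ¬ (h ≈ ε) × ¬ (∃[ x ] (O⁺Type x × Between h g x))
  T-valued g≉ε vg (T-ε g≈ε _)          = contradiction g≈ε g≉ε
  T-valued g≉ε vg (T-v _ _ vh h≉ε ¬o)  = vh , h≉ε , ¬o
  T-valued g≉ε vg (T-o⁺ og _)          = contradiction vg (O⁺-≈±⇒¬VType og (inj₁ refl))
  T-valued g≉ε vg (T-o⁻ (_ , g≁g⁻¹) _) = contradiction vg g≁g⁻¹

  -- An o⁻ step replaces `g` by `g ⁻¹` and keeps `p`, so membership descends to `T⁺` between o⁺-type
  -- representatives.
  T-ordered : ∀ {g h p} → O⁺Type p → g ≈± p → T g h → ∃[ q ] (T⁺ p q × h ≈± q)
  T-ordered op g≈±p (T-ε g≈ε _)          = contradiction (VType-ε g≈ε) (O⁺-≈±⇒¬VType op g≈±p)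
  T-ordered op g≈±p (T-v _ vg _ _ _)     = contradiction vg (O⁺-≈±⇒¬VType op g≈±p)
  T-ordered op (inj₂ g≈p⁻¹) (T-o⁺ og _) = contradiction (O⁺-resp-≈ g≈p⁻¹ og) (O⁺-⁻¹ op)
  T-ordered op (inj₁ g≈p) (T-o⁺ _ (inj₁ t)) = _ , T⁺-respˡ-≈ g≈p t , inj₁ refl
  T-ordered op (inj₁ g≈p) (T-o⁺ _ (inj₂ (q , t , h≈q⁻¹))) =
    q , T⁺-respˡ-≈ g≈p t , inj₂ h≈q⁻¹
  T-ordered op g≈±p (T-o⁻ _ t)           = T-ordered op (≈±-⁻¹ g≈±p) t

  T-ordered⁻ : ∀ {g h p q} → O⁺Type p → g ≈± p → T⁺ p q → h ≈± q → T g h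
  T-ordered⁻ {h = h} {p} {q} op g≈±p t h≈±q = by-sign g≈±p
    where
    T⁺-h : ∀ {g} → g ≈ p → h ≈± q → (T⁺ g ∪ Inverses (T⁺ g)) h
    T⁺-h g≈p (inj₁ h≈q)   = inj₁ (T⁺-respʳ-≈ (sym h≈q) (T⁺-respˡ-≈ (sym g≈p) t))
    T⁺-h g≈p (inj₂ h≈q⁻¹) = inj₂ (q , T⁺-respˡ-≈ (sym g≈p) t , h≈q⁻¹)

    positive : ∀ {g} → g ≈ p → T g h
    positive g≈p = T-o⁺ (O⁺-resp-≈ (sym g≈p) op) (T⁺-h g≈p h≈±q)

    by-sign : ∀ {g} → g ≈± p → T g h
    by-sign (inj₁ g≈p)   = positive g≈p
    by-sign (inj₂ g≈p⁻¹) = T-o⁻ (O⁻-intro op g≈p⁻¹) (positive (⁻¹-flip g≈p⁻¹))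

  T-refl : ∀ g → T g g
  T-refl g with kind g
  ... | trivial g≈ε     = T-ε g≈ε g≈ε
  ... | valued g≉ε vg   = T-v g≉ε vg vg g≉ε λ (x , ox , g-x-g) →
    -- Here `x ∼ g`, so `g` would be o⁺-type like `x`.
    let g≾x , x≾g = Between-≾ ≾-refl g-x-g
        _ , o     = T⁺-refl ox
    in O⁺-≈±⇒¬VType (o g (inj₁ (x≾g , g≾x))) (inj₁ refl) vg
  ... | ordered op g≈±p = T-ordered⁻ op g≈±p (T⁺-refl op) g≈±p

  T-sym : ∀ {g h} → T g h → T h g
  T-sym {g} t with kind g
  ... | trivial g≈ε     = T-ε (T-trivial g≈ε t) g≈ε
  ... | valued g≉ε vg   =
    let vh , h≉ε , ¬o = T-valued g≉ε vg t
    in T-v h≉ε vh vg g≉ε λ (x , ox , g-x-h) → ¬o (x , ox , Sum.swap g-x-h)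
  ... | ordered op g≈±p =
    let q , t⁺ , h≈±q = T-ordered op g≈±p t
    in T-ordered⁻ (proj₁ t⁺) h≈±q (T⁺-sym t⁺) g≈±p

  T-trans : ∀ {g h k} → T g h → T h k → T g k
  T-trans {g} t u with kind g
  ... | trivial g≈ε     = T-ε g≈ε (T-trivial (T-trivial g≈ε t) u)
  ... | valued g≉ε vg   =
    let vh , h≉ε , ¬o₁ = T-valued g≉ε vg t
        vk , k≉ε , ¬o₂ = T-valued h≉ε vh u
    in T-v g≉ε vg vk k≉ε λ (x , ox , k-x-g) →
         [ (λ k-x-h → ¬o₂ (x , ox , k-x-h)) , (λ h-x-g → ¬o₁ (x , ox , h-x-g)) ]′
           (Between-split k-x-g)
  ... | ordered op g≈±p =
    let q , t⁺ , h≈±q = T-ordered op g≈±p t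
        k , u⁺ , k≈±  = T-ordered (proj₁ t⁺) h≈±q u
    in T-ordered⁻ op g≈±p (T⁺-trans t⁺ u⁺) k≈±

  -- Membership in `G↓` by kind, and its constancy on `T`-classes.

  G↓-trivial : ∀ {g h} → g ≈ ε → G↓ g h → h ≈ ε
  G↓-trivial g≈ε (G-ε _ h≈ε)    = h≈ε
  G↓-trivial g≈ε (G-v g≉ε _ _)  = contradiction g≈ε g≉ε
  G↓-trivial g≈ε (G-o⁺ og _ _)  = contradiction (VType-ε g≈ε) (O⁺-≈±⇒¬VType og (inj₁ refl))
  G↓-trivial g≈ε (G-o⁻ (_ , g≁g⁻¹) _) = contradiction (VType-ε g≈ε) g≁g⁻¹

  G↓-valued : ∀ {g h} → ¬ (g ≈ ε) → VType g → G↓ g h → ∀ t → T g t → h ≺ t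
  G↓-valued g≉ε vg (G-ε g≈ε _)          = contradiction g≈ε g≉ε
  G↓-valued g≉ε vg (G-v _ _ h<T) t gTt  = ⋨⇒≺ (h<T t gTt)
  G↓-valued g≉ε vg (G-o⁺ og _ _)        = contradiction vg (O⁺-≈±⇒¬VType og (inj₁ refl))
  G↓-valued g≉ε vg (G-o⁻ (_ , g≁g⁻¹) _) = contradiction vg g≁g⁻¹

  G↓-ordered : ∀ {g h p} → O⁺Type p → g ≈± p → G↓ g h → h ≾ p ⁻¹ × h ⁻¹ ≾ p ⁻¹
  G↓-ordered op g≈±p (G-ε g≈ε _)    = contradiction (VType-ε g≈ε) (O⁺-≈±⇒¬VType op g≈±p)
  G↓-ordered op g≈±p (G-v _ vg _)   = contradiction vg (O⁺-≈±⇒¬VType op g≈±p)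
  G↓-ordered op (inj₁ g≈p) (G-o⁺ _ h≾g⁻¹ h⁻¹≾g⁻¹) =
    ≾-≈ refl (⁻¹-cong g≈p) h≾g⁻¹ , ≾-≈ refl (⁻¹-cong g≈p) h⁻¹≾g⁻¹
  G↓-ordered op (inj₂ g≈p⁻¹) (G-o⁺ og _ _) = contradiction (O⁺-resp-≈ g≈p⁻¹ og) (O⁺-⁻¹ op)
  G↓-ordered op g≈±p (G-o⁻ _ h∈G)   = G↓-ordered op (≈±-⁻¹ g≈±p) h∈G

  G↓-ordered⁻ : ∀ {g h p} → O⁺Type p → g ≈± p → h ≾ p ⁻¹ → h ⁻¹ ≾ p ⁻¹ → G↓ g h
  G↓-ordered⁻ {h = h} {p} op g≈±p h≾p⁻¹ h⁻¹≾p⁻¹ = by-sign g≈±p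
    where
    positive : ∀ {g} → g ≈ p → G↓ g h
    positive g≈p = G-o⁺ (O⁺-resp-≈ (sym g≈p) op)
                        (≾-≈ refl (⁻¹-cong (sym g≈p)) h≾p⁻¹)
                        (≾-≈ refl (⁻¹-cong (sym g≈p)) h⁻¹≾p⁻¹)

    by-sign : ∀ {g} → g ≈± p → G↓ g h
    by-sign (inj₁ g≈p)   = positive g≈p
    by-sign (inj₂ g≈p⁻¹) = G-o⁻ (O⁻-intro op g≈p⁻¹) (positive (⁻¹-flip g≈p⁻¹))

  -- In the v-type case both sets lie strictly below the same class; in the ordered case the bounds
  -- `p ⁻¹` and `q ⁻¹` are equivalent.
  T⇒G↓⊆ : ∀ {g h} → T g h → G↓ g ⊆ G↓ h
  T⇒G↓⊆ {g} t x∈G with kind g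
  ... | trivial g≈ε     = G-ε (T-trivial g≈ε t) (G↓-trivial g≈ε x∈G)
  ... | valued g≉ε vg   =
    let vh , h≉ε , _ = T-valued g≉ε vg t
    in G-v h≉ε vh λ k u → ≺⇒⋨ (G↓-valued g≉ε vg x∈G k (T-trans t u))
  ... | ordered op g≈±p =
    let q , t⁺ , h≈±q   = T-ordered op g≈±p t
        x≾p⁻¹ , x⁻¹≾p⁻¹ = G↓-ordered op g≈±p x∈G
        p⁻¹≾q⁻¹ , _     = T⁺⇒⁻¹-∼ t⁺
    in G↓-ordered⁻ (proj₁ t⁺) h≈±q (≾-trans x≾p⁻¹ p⁻¹≾q⁻¹) (≾-trans x⁻¹≾p⁻¹ p⁻¹≾q⁻¹)

  T⇒G↓≐ : ∀ {g h} → T g h → G↓ g ≐ G↓ h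
  T⇒G↓≐ t = T⇒G↓⊆ t , T⇒G↓⊆ (T-sym t)

  -- Comparison of distinct classes.

  ε∈G↓ : ∀ {g} h → g ≈ ε → G↓ h g
  ε∈G↓ {g} h g≈ε with kind h
  ... | trivial h≈ε     = G-ε h≈ε g≈ε
  ... | valued h≉ε vh   = G-v h≉ε vh λ t u →
    let _ , t≉ε , _ = T-valued h≉ε vh u
    in ≺⇒⋨ (ε≺ t≉ε ∘ ≾-≈ refl g≈ε)
  ... | ordered op h≈±p = G↓-ordered⁻ op h≈±p (≾-≈ (sym g≈ε) refl (ε≾ _))
    (≾-≈ (trans (sym ε⁻¹≈ε) (⁻¹-cong (sym g≈ε))) refl (ε≾ _))

  -- A `t` in `T g` with `t ≾ h` would have the o⁺-type `x` between it and `g`.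
  valued-separated⇒G↓ : ∀ {g h x} → ¬ (g ≈ ε) → VType g → O⁺Type x → h ≾ x → x ≾ g → G↓ g h
  valued-separated⇒G↓ g≉ε vg ox h≾x x≾g = G-v g≉ε vg λ t u →
    let _ , _ , ¬o = T-valued g≉ε vg u
    in ≺⇒⋨ λ t≾h → ¬o (_ , ox , inj₁ (≾-trans t≾h h≾x , x≾g))

  -- If `g ≾ q ⁻¹`, the same holds for `g ⁻¹ ∼ g`. Otherwise `q ⁻¹` is strictly below both, hence
  -- `q ≺ g`, and `q` separates `h` from `g`.
  valued-ordered⇒G↓⊎G↓ : ∀ {g h q} → ¬ (g ≈ ε) → VType g → O⁺Type q → h ≈± q →
                        G↓ h g ⊎ G↓ g h
  valued-ordered⇒G↓⊎G↓ {g} {q = q} g≉ε vg oq h≈±q with em-r {g ≾ q ⁻¹}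
  ... | yes g≾q⁻¹ =
    inj₁ (G↓-ordered⁻ oq h≈±q g≾q⁻¹ (≾-trans (proj₂ vg) g≾q⁻¹))
  ... | no q⁻¹≺g  =
    let q≺g = h⁻¹≺y,y⁻¹⇒h≺y q⁻¹≺g (λ g⁻¹≾q⁻¹ → q⁻¹≺g (≾-trans (proj₁ vg) g⁻¹≾q⁻¹))
    in inj₂ (valued-separated⇒G↓ g≉ε vg oq (O⁺-≈±-≾ oq h≈±q) (≺⇒≾ q≺g))

  -- The obstruction gives `p ≾ y ≾ q ⁻¹`, and `p` bounds both `g` and `g ⁻¹`.
  ordered-separated⇒G↓ : ∀ {g h p q y} → O⁺Type p → g ≈± p → O⁺Type q → h ≈± q →
                 ¬ O⁺Type y → p ≾ y → y ≾ q → G↓ h g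
  ordered-separated⇒G↓ op g≈±p oq h≈±q ¬oy p≾y y≾q =
    let p≾q⁻¹ = ≾-trans p≾y (¬O⁺∧≾⇒≾⁻¹ ¬oy y≾q)
    in G↓-ordered⁻ oq h≈±q (≾-trans (O⁺-≈±-≾ op g≈±p) p≾q⁻¹)
                            (≾-trans (O⁺-≈±-≾ op (≈±-⁻¹ g≈±p)) p≾q⁻¹)

  -- For nontrivial elements of like kind, failure of `T` yields a separating element: o⁺-type
  -- between v-types, not o⁺-type between o⁺-type representatives. The order around it decides which
  -- `G↓` contains the other element.
  T⊎G↓⊎G↓ : ∀ g h → T g h ⊎ G↓ h g ⊎ G↓ g h
  T⊎G↓⊎G↓ g h with kind g | kind h
  ... | trivial g≈ε     | _               = inj₂ (inj₁ (ε∈G↓ h g≈ε))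
  ... | _               | trivial h≈ε     = inj₂ (inj₂ (ε∈G↓ g h≈ε))
  ... | valued g≉ε vg   | ordered oq h≈±q =
    inj₂ (valued-ordered⇒G↓⊎G↓ g≉ε vg oq h≈±q)
  ... | ordered op g≈±p | valued h≉ε vh   =
    inj₂ (Sum.swap (valued-ordered⇒G↓⊎G↓ h≉ε vh op g≈±p))
  ... | valued g≉ε vg   | valued h≉ε vh
    with em-cr {∃[ x ] (O⁺Type x × Between h g x)}
  ...   | no ¬o                             = inj₁ (T-v g≉ε vg vh h≉ε ¬o)
  ...   | yes (x , ox , inj₁ (h≾x , x≾g)) =
    inj₂ (inj₂ (valued-separated⇒G↓ g≉ε vg ox h≾x x≾g))
  ...   | yes (x , ox , inj₂ (g≾x , x≾h)) =
    inj₂ (inj₁ (valued-separated⇒G↓ h≉ε vh ox g≾x x≾h))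
  T⊎G↓⊎G↓ g h | ordered {p} op g≈±p | ordered {q} oq h≈±q
    with em-cr {∃[ y ] (Between p q y × ¬ O⁺Type y)}
  ...   | yes (y , inj₁ (p≾y , y≾q) , ¬oy) =
    inj₂ (inj₁ (ordered-separated⇒G↓ op g≈±p oq h≈±q ¬oy p≾y y≾q))
  ...   | yes (y , inj₂ (q≾y , y≾p) , ¬oy) =
    inj₂ (inj₂ (ordered-separated⇒G↓ oq h≈±q op g≈±p ¬oy q≾y y≾p))
  ...   | no ∄y = inj₁ (T-ordered⁻ op g≈±p (oq , λ x p-x-q →
    decidable-stable em-r (λ ¬ox → ∄y (x , p-x-q , ¬ox))) h≈±q)

  -- Irreflexivity and antisymmetry of `G↓`.

  g∉G↓g : ∀ {g} → ¬ (g ≈ ε) → ¬ G↓ g g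
  g∉G↓g {g} g≉ε g∈G with kind g
  ... | trivial g≈ε     = g≉ε g≈ε
  ... | valued _ vg     = G↓-valued g≉ε vg g∈G g (T-refl g) ≾-refl
  ... | ordered op g≈±p =
    let g≾p⁻¹ , g⁻¹≾p⁻¹ = G↓-ordered op g≈±p g∈G
    in ⋨⇒≺ op (≈±-≾ (≈±-sym g≈±p) g≾p⁻¹ g⁻¹≾p⁻¹)

  -- One membership gives `h ≺ g`, the other `g ≾ q ⁻¹ ≾ h`.
  G↓-valued-ordered-asym : ∀ {g h q} → ¬ (g ≈ ε) → VType g → O⁺Type q → h ≈± q →
                           G↓ h g → ¬ G↓ g h
  G↓-valued-ordered-asym g≉ε vg oq h≈±q g∈Gh h∈Gg =
    G↓-valued g≉ε vg h∈Gg _ (T-refl _)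
      (≾-trans (proj₁ (G↓-ordered oq h≈±q g∈Gh)) (O⁺-≈±-≿ oq h≈±q))

  -- Both memberships hold only for trivial `g` and `h`; otherwise they conflict, as in
  -- `p ≾ q ⁻¹ ≾ q ≾ p ⁻¹` for ordered elements.
  G↓-antisym : ∀ {g h} → G↓ h g → G↓ g h → T g h
  G↓-antisym {g} {h} g∈Gh h∈Gg with kind g | kind h
  ... | trivial g≈ε     | _               = T-ε g≈ε (G↓-trivial g≈ε h∈Gg)
  ... | _               | trivial h≈ε     = T-ε (G↓-trivial h≈ε g∈Gh) h≈ε
  ... | valued g≉ε vg   | ordered oq h≈±q =
    contradiction h∈Gg (G↓-valued-ordered-asym g≉ε vg oq h≈±q g∈Gh)
  ... | ordered op g≈±p | valued h≉ε vh   =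
    contradiction g∈Gh (G↓-valued-ordered-asym h≉ε vh op g≈±p h∈Gg)
  ... | valued g≉ε vg   | valued h≉ε vh   =
    contradiction (≺⇒≾ (G↓-valued g≉ε vg h∈Gg g (T-refl g)))
                  (G↓-valued h≉ε vh g∈Gh h (T-refl h))
  ... | ordered op g≈±p | ordered oq h≈±q =
    let g≾q⁻¹ , g⁻¹≾q⁻¹ = G↓-ordered oq h≈±q g∈Gh
        h≾p⁻¹ , h⁻¹≾p⁻¹ = G↓-ordered op g≈±p h∈Gg
        p≾q⁻¹ = ≈±-≾ (≈±-sym g≈±p) g≾q⁻¹ g⁻¹≾q⁻¹
        q≾p⁻¹ = ≈±-≾ (≈±-sym h≈±q) h≾p⁻¹ h⁻¹≾p⁻¹
    in contradiction (≾-trans p≾q⁻¹ (≾-trans (proj₁ oq) q≾p⁻¹)) (⋨⇒≺ op)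

  -- The equivalences with `T h g`.

  T⇒T≐ : ∀ {g h} → T g h → T g ≐ T h
  T⇒T≐ gTh = T-trans (T-sym gTh) , T-trans gTh

  T⇔T≐ : ∀ g h → T h g ⇔ (T g ≐ T h)
  T⇔T≐ g h = mk⇔ (T⇒T≐ ∘ T-sym) (λ (Tg⊆Th , _) → Tg⊆Th (T-refl g))

  T⇔T≬ : ∀ g h → T h g ⇔ (T g ≬ T h)
  T⇔T≬ g h = mk⇔ (λ t → g , T-refl g , t) (λ (x , gTx , hTx) → T-trans hTx (T-sym gTx))

  -- `G↓ ε` contains only `ε` and may equal `G↓` of a nontrivial element; matching triviality
  -- excludes this. Without `T`, a nontrivial element would lie in its own `G↓`.
  G↓≐⇒T : ∀ {g h} → (g ≈ ε ⇔ h ≈ ε) → G↓ g ≐ G↓ h → T g h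
  G↓≐⇒T {g} {h} g≈ε⇔h≈ε (Gg⊆Gh , Gh⊆Gg) with em-ℓ {g ≈ ε} | T⊎G↓⊎G↓ g h
  ... | yes g≈ε | _                = T-ε g≈ε (Equivalence.to g≈ε⇔h≈ε g≈ε)
  ... | no _    | inj₁ t           = t
  ... | no g≉ε  | inj₂ (inj₁ g∈Gh) = contradiction (Gh⊆Gg g∈Gh) (g∉G↓g g≉ε)
  ... | no g≉ε  | inj₂ (inj₂ h∈Gg) =
    contradiction (Gg⊆Gh h∈Gg) (g∉G↓g (g≉ε ∘ Equivalence.from g≈ε⇔h≈ε))

  T⇒G↑⊆ : ∀ {g h} → T g h → G↑ g ⊆ G↑ h
  T⇒G↑⊆ t = Sum.map (T⇒G↓⊆ t) (T-trans (T-sym t))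

  T⇒G↑≐ : ∀ {g h} → T g h → G↑ g ≐ G↑ h
  T⇒G↑≐ t = T⇒G↑⊆ t , T⇒G↑⊆ (T-sym t)

  T⇔G↑≐ : ∀ g h → T h g ⇔ (G↑ g ≐ G↑ h)
  T⇔G↑≐ g h = mk⇔ (T⇒G↑≐ ∘ T-sym) from
    where
    from : G↑ g ≐ G↑ h → T h g
    -- Each element is in its own `G↑`, hence in the other one.
    from (Gg⊆Gh , Gh⊆Gg) with Gg⊆Gh (inj₂ (T-refl g)) | Gh⊆Gg (inj₂ (T-refl h))
    ... | inj₂ hTg  | _         = hTg
    ... | inj₁ _    | inj₂ gTh  = T-sym gTh
    ... | inj₁ g∈Gh | inj₁ h∈Gg = T-sym (G↓-antisym g∈Gh h∈Gg)

proposition3p32 : ∀ {c ℓ r s : Level} → ExcludedMiddle (c ⊔ ℓ ⊔ r ⊔ s) →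
  (𝔾 : CQuasiOrderedGroup c ℓ r s) →
  let open CQuasiOrderedGroup 𝔾
      open Types 𝔾 in
  (g h : Carrier) →
  -- All six conditions, when g and h are both trivial or both nontrivial.
  ((g ≈ ε ⇔ h ≈ ε) →
    AllEquivalent ((g ∈ T h) ∷ (h ∈ T g) ∷ (T g ≐ T h) ∷ (T g ≬ T h) ∷ (G↓ g ≐ G↓ h) ∷ (G↑ g ≐ G↑ h) ∷ []))
  -- With no restriction: only (G↓ g ≐ G↓ h → g ∈ T h) may fail, for exactly one of g, h trivial.
  × AllEquivalent ((g ∈ T h) ∷ (h ∈ T g) ∷ (T g ≐ T h) ∷ (T g ≬ T h) ∷ (G↑ g ≐ G↑ h) ∷ [])
  × (g ∈ T h → G↓ g ≐ G↓ h)
proposition3p32 em 𝔾 g h =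
    (λ g≈ε⇔h≈ε → allEquivalent
      (T-comm ∷ T⇔T≐ g h ∷ T⇔T≬ g h
       ∷ mk⇔ (T⇒G↓≐ ∘ T-sym) (T-sym ∘ G↓≐⇒T g≈ε⇔h≈ε) ∷ T⇔G↑≐ g h ∷ []))
  , allEquivalent (T-comm ∷ T⇔T≐ g h ∷ T⇔T≬ g h ∷ T⇔G↑≐ g h ∷ [])
  , T⇒G↓≐ ∘ T-sym
  where
  open CQuasiOrder em 𝔾
  T-comm = mk⇔ T-sym T-sym
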